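{- Let $L/K$ be a finite extension with maximal separable subextension $L_S/K$. The number of distinct extensions $L'/K$ (inside $\bar K$) that are isomorphic to $L/K$ and satisfy $L'_S=L_S$ is exactly $s_K(L)/s_K(L_S)$.
   Context: $K$ is any field (not necessarily perfect) with a fixed algebraic closure $\bar K$; all extensions are finite and contained in $\bar K$. For an extension $E/K$, $E_S$ denotes its maximal separable subextension, and $s_K(E)$ is the number of distinct subfields of $\bar K$ isomorphic to $E$ over $K$. -}

module Defs where

open import Level using (Level; suc; _⊔_)
open import Algebra.Apartness using (HeytingField; HeytingCommutativeRing)
open import Algebra.Bundles using (CommutativeRing; RawRing)
open import Algebra.Morphism.Structures using (module RingMorphisms)
import Algebra.Properties.Monoid.Sum as Sum
open import Data.Fin using (Fin)
open import Data.List using (List; []; _∷_; foldr; map)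
open import Data.Nat as ℕ using (ℕ)
open import Data.Product using (Σ; ∃; ∃-syntax; _×_; _,_; proj₁; proj₂)
open import Function.Bundles using (Inverse)
open import Relation.Binary.Bundles using (Setoid)
import Relation.Binary.PropositionalEquality as ≡
open import Relation.Nullary using (¬_)
open import Relation.Unary using (Pred; _⊆_; _≐_)
open import Relation.Unary.Properties using (≐-refl; ≐-sym; ≐-trans)

open RingMorphisms using (IsRingHomomorphism; IsRingIsomorphism)

-- Polynomials are coefficient lists, constant term first; trailing zeros
-- are allowed, so equality of polynomials is _≈ₚ_.
module Polynomials {c ℓ} (R : CommutativeRing c ℓ) where
  open CommutativeRing R

  Poly : Set c
  Poly = List Carrier

  coeff : Poly → ℕ → Carrier
  coeff []      _         = 0#
  coeff (a ∷ _) ℕ.zero    = a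
  coeff (_ ∷ p) (ℕ.suc i) = coeff p i

  infix 4 _≈ₚ_ _∣ₚ_
  infixl 6 _+ₚ_
  infixl 7 _*ₚ_

  _≈ₚ_ : Poly → Poly → Set ℓ
  p ≈ₚ q = ∀ i → coeff p i ≈ coeff q i

  _+ₚ_ : Poly → Poly → Poly
  []      +ₚ q       = q
  (a ∷ p) +ₚ []      = a ∷ p
  (a ∷ p) +ₚ (b ∷ q) = (a + b) ∷ (p +ₚ q)

  _*ₚ_ : Poly → Poly → Poly
  []      *ₚ q = []
  (a ∷ p) *ₚ q = map (a *_) q +ₚ (0# ∷ (p *ₚ q))

  _∣ₚ_ : Poly → Poly → Set (c ⊔ ℓ)
  p ∣ₚ q = ∃[ r ] r *ₚ p ≈ₚ q

  X-_ : Carrier → Poly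
  X- a = - a ∷ 1# ∷ []

  eval : Poly → Carrier → Carrier
  eval p x = foldr (λ a s → a + x * s) 0# p

  -- The zero polynomial has no degree.
  HasDegree : Poly → ℕ → Set ℓ
  HasDegree p n = ¬ (coeff p n ≈ 0#) × (∀ i → n ℕ.< i → coeff p i ≈ 0#)

  Monic : Poly → ℕ → Set ℓ
  Monic p n = HasDegree p n × coeff p n ≈ 1#

-- With excluded middle a HeytingField is exactly a field in the usual sense:
-- x # y is then equivalent to ¬ (x ≈ y).
fieldRing : ∀ {c ℓ₁ ℓ₂} → HeytingField c ℓ₁ ℓ₂ → CommutativeRing c ℓ₁
fieldRing F = HeytingCommutativeRing.commutativeRing (HeytingField.heytingCommutativeRing F)

record AlgebraicClosure {ℓ} (K : HeytingField ℓ ℓ ℓ) : Set (suc ℓ) where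
  field
    closure : HeytingField ℓ ℓ ℓ

  private
    module K  = CommutativeRing (fieldRing K)
    module K̄  = CommutativeRing (fieldRing closure)
    module K[X] = Polynomials (fieldRing K)
    module K̄[X] = Polynomials (fieldRing closure)

  field
    -- Automatically injective, K being a field and the closure nontrivial.
    ι                   : K.Carrier → K̄.Carrier
    ι-isHomomorphism    : IsRingHomomorphism K.rawRing K̄.rawRing ι
    algebraic           : ∀ x → ∃[ p ] ∃[ n ] K[X].HasDegree p n × K̄[X].eval (map ι p) x K̄.≈ K̄.0#
    algebraicallyClosed : ∀ p n → K̄[X].HasDegree p (ℕ.suc n) → ∃[ x ] K̄[X].eval p x K̄.≈ K̄.0#

module Extensions {ℓ} {K : HeytingField ℓ ℓ ℓ} (closureK : AlgebraicClosure K) where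
  open AlgebraicClosure closureK

  private
    module K  = CommutativeRing (fieldRing K)
    module K̄  = CommutativeRing (fieldRing closure)
    module K[X] = Polynomials (fieldRing K)
    module K̄[X] = Polynomials (fieldRing closure)
    module ι  = IsRingHomomorphism ι-isHomomorphism

  -- Extensions of K inside the closure, as intermediate fields.
  record Extension : Set (suc ℓ) where
    field
      Mem        : Pred K̄.Carrier ℓ
      resp       : ∀ {x y} → x K̄.≈ y → Mem x → Mem y
      ι-mem      : ∀ k → Mem (ι k)
      +-closed   : ∀ {x y} → Mem x → Mem y → Mem (x K̄.+ y)
      neg-closed : ∀ {x} → Mem x → Mem (K̄.- x)
      *-closed   : ∀ {x y} → Mem x → Mem y → Mem (x K̄.* y)
      inv-closed : ∀ {x y} → x K̄.* y K̄.≈ K̄.1# → Mem x → Mem y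

    rawRing : RawRing ℓ ℓ
    rawRing = record
      { Carrier = Σ K̄.Carrier Mem
      ; _≈_     = λ x y → proj₁ x K̄.≈ proj₁ y
      ; _+_     = λ x y → proj₁ x K̄.+ proj₁ y , +-closed (proj₂ x) (proj₂ y)
      ; _*_     = λ x y → proj₁ x K̄.* proj₁ y , *-closed (proj₂ x) (proj₂ y)
      ; -_      = λ x → K̄.- proj₁ x , neg-closed (proj₂ x)
      ; 0#      = K̄.0# , resp ι.0#-homo (ι-mem K.0#)
      ; 1#      = K̄.1# , resp ι.1#-homo (ι-mem K.1#)
      }

  open Extension using (Mem; ι-mem)

  infix 4 _≤_ _≐ₑ_ _≅_

  _≤_ : Extension → Extension → Set ℓ
  E ≤ F = Mem E ⊆ Mem F

  _≐ₑ_ : Extension → Extension → Set ℓ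
  E ≐ₑ F = Mem E ≐ Mem F

  record _≅_ (E F : Extension) : Set ℓ where
    field
      to            : Σ K̄.Carrier (Mem E) → Σ K̄.Carrier (Mem F)
      isIsomorphism : IsRingIsomorphism (Extension.rawRing E) (Extension.rawRing F) to
      fixes-K       : ∀ k → proj₁ (to (ι k , ι-mem E k)) K̄.≈ ι k

  -- Finite dimension over K, as the existence of a finite spanning family.
  IsFinite : Extension → Set ℓ
  IsFinite E =
    ∃[ n ] Σ (Fin n → K̄.Carrier) λ b →
      (∀ i → Mem E (b i)) ×
      (∀ x → Mem E x → Σ (Fin n → K.Carrier) λ a → x K̄.≈ sum (λ i → ι (a i) K̄.* b i))
    where open Sum K̄.+-monoid using (sum)

  Root : K[X].Poly → K̄.Carrier → Set ℓ
  Root p x = K̄[X].eval (map ι p) x K̄.≈ K̄.0#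

  IsMinimalPolynomial : K[X].Poly → K̄.Carrier → Set ℓ
  IsMinimalPolynomial p x =
    ∃[ n ] K[X].Monic p n × Root p x ×
      (∀ q m → K[X].HasDegree q m → Root q x → n ℕ.≤ m)

  -- No multiple root in the closure.
  IsSeparablePolynomial : K[X].Poly → Set ℓ
  IsSeparablePolynomial p = ∀ y → ¬ ((X- y) *ₚ (X- y) ∣ₚ map ι p)
    where open K̄[X]

  IsSeparableElement : K̄.Carrier → Set ℓ
  IsSeparableElement x = ∃[ p ] IsMinimalPolynomial p x × IsSeparablePolynomial p

  IsSeparable : Extension → Set ℓ
  IsSeparable E = ∀ x → Mem E x → IsSeparableElement x

  -- M = E_S.  Such an M is unique up to _≐ₑ_, so "E′_S = M" is expressed
  -- as IsMaximalSeparable M E′.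
  IsMaximalSeparable : Extension → Extension → Set (suc ℓ)
  IsMaximalSeparable M E =
    M ≤ E × IsSeparable M × (∀ F → F ≤ E → IsSeparable F → F ≤ M)

  -- Extensions satisfying P, two of them identified when they have the same
  -- elements.
  extensionsWith : ∀ {p} → Pred Extension p → Setoid (suc ℓ ⊔ p) ℓ
  extensionsWith P = record
    { Carrier       = Σ Extension P
    ; _≈_           = λ E F → proj₁ E ≐ₑ proj₁ F
    ; isEquivalence = record { refl = ≐-refl ; sym = ≐-sym ; trans = ≐-trans }
    }

  HasCardinality : ∀ {p} → Pred Extension p → ℕ → Set (suc ℓ ⊔ p)
  HasCardinality P n = Inverse (≡.setoid (Fin n)) (extensionsWith P)

  s[_]=_ : Extension → ℕ → Set (suc ℓ)
  s[ E ]= n = HasCardinality (_≅ E) n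

{-# OPTIONS --safe #-}
-- Write K(u) for the field generated by a tuple u.  Its embeddings into K̄ are
-- the tuples v at which every polynomial expression vanishing at u vanishes,
-- written u ∼ v.  Adjoining one element at a time, with a root of the transported
-- minimal polynomial as image, extends every embedding to any further finite
-- tuple.  Choose u to list all roots of finitely many polynomials over K that have
-- generators of L among their roots: K(u) is normal, contains L, and all
-- conjugates of L and of Lₛ are images of these under permutations of u, hence
-- finite in number.  For each conjugate M of Lₛ fix an automorphism σ of K(u)
-- with σ(Lₛ) = M.  As (σE)_S = σ(E_S), the map (M, L′) ↦ σ(L′) is a bijection from
-- pairs with L′_S = Lₛ onto the conjugates of L, so s(L) = s(Lₛ) · c.
module Submission where

open import Defs
open import Level using (_⊔_)
open import Algebra.Apartness using (HeytingField)
open import Algebra.Bundles using (CommutativeRing; module RawRing)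
open import Algebra.Morphism.Structures using (module RingMorphisms)
open import Axiom.ExcludedMiddle using (ExcludedMiddle)
open import Data.Empty using (⊥-elim)
open import Data.Fin.Base
  using (Fin; zero; suc; combine; remQuot; punchOut; finToFun; funToFin)
open import Data.Fin.Properties
  using (remQuot-combine; combine-remQuot; finToFun-funToFin; injective⇒≤; punchOut-injective;
         any?; _≟_; nonZeroIndex)
open import Data.Integer using (+_)
import Data.Integer as ℤ
import Data.Integer.Properties as ℤ
open import Data.List.Base using ([]; _∷_; _++_; map; length; lookup)
open import Data.List.Properties using (length-++)
open import Data.List.Relation.Unary.All using (All; []; _∷_)
open import Data.List.Relation.Unary.Any as Any using (Any; here; there)
import Data.List.Relation.Unary.Any.Properties as Any
open import Data.Maybe.Base using (just; nothing; maybe′)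
open import Data.Nat.Base as ℕ using (ℕ; zero; suc; NonZero)
open import Data.Nat.Induction using (<-rec)
import Data.Nat.Properties as ℕ
open import Data.Product using (Σ; ∃; ∃-syntax; _×_; _,_; proj₁; proj₂)
open import Data.Rational using (_/_)
open import Data.Rational.Properties using (fromℚᵘ-cong)
open import Data.Rational.Unnormalised.Base using (mkℚᵘ; *≡*)
open import Data.Sum.Base using (inj₁; inj₂; [_,_]′)
open import Data.Vec.Base as Vec using (Vec; []; _∷_)
open import Data.Vec.Functional using () renaming (_∷_ to _◂_)
open import Data.Vec.Relation.Unary.All as VecAll using ([]; _∷_)
open import Function.Base using (_∘_; id)
open import Function.Bundles using (Inverse)
open import Relation.Binary.Bundles using (Setoid)
open import Relation.Binary.PropositionalEquality as ≡ using (_≡_)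
open import Relation.Nullary using (¬_; yes; no)
open import Relation.Unary using (_⊆_)
open import Relation.Unary.Properties using (≐-refl; ≐-sym; ≐-trans)

-- Finite enumerations of setoids by excluded middle.

module Enumeration {ℓ} (em : ExcludedMiddle ℓ) {c} (S : Setoid c ℓ) where
  open Setoid S

  Distinct : ∀ {n} → (Fin n → Carrier) → Set ℓ
  Distinct h = ∀ {i j} → h i ≈ h j → i ≡ j

  IsEnumeration : ∀ {n} → (Fin n → Carrier) → Set (c ⊔ ℓ)
  IsEnumeration h = Distinct h × (∀ s → ∃[ j ] h j ≈ s)

  -- Excluded middle decides, index by index, whether `Q i` holds and whether its value is already
  -- listed. The irrelevance hypothesis makes the value depend on the index alone, so one proof of
  -- `Q i` stands for all.
  dedupe : ∀ {m} (Q : Fin m → Set ℓ) (g : ∀ i → Q i → Carrier) →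
           (∀ i q q′ → g i q ≈ g i q′) →
           ∃[ n ] Σ (Fin n → Carrier) λ h → Distinct h × (∀ i q → ∃[ j ] h j ≈ g i q)
  dedupe {zero}  Q g irr = 0 , (λ ()) , (λ {}) , λ ()
  dedupe {suc m} Q g irr with dedupe (Q ∘ suc) (g ∘ suc) (irr ∘ suc) | em {Q zero}
  ... | n , h , inj , cov | no ¬q =
    n , h , inj , λ { zero q → ⊥-elim (¬q q) ; (suc i) → cov i }
  ... | n , h , inj , cov | yes q with em {∃[ j ] h j ≈ g zero q}
  ...   | yes (j , eq) =
    n , h , inj , λ { zero q′ → j , trans eq (irr zero q q′) ; (suc i) → cov i }
  ...   | no new = suc n , g zero q ◂ h , inj′ , cov′
    where
    inj′ : Distinct (g zero q ◂ h)
    inj′ {zero}  {zero}  _  = ≡.refl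
    inj′ {zero}  {suc j} eq = ⊥-elim (new (j , sym eq))
    inj′ {suc i} {zero}  eq = ⊥-elim (new (i , eq))
    inj′ {suc i} {suc j} eq = ≡.cong suc (inj eq)
    cov′ : ∀ i q′ → ∃[ j ] (g zero q ◂ h) j ≈ g i q′
    cov′ zero    q′ = zero , irr zero q q′
    cov′ (suc i) q′ with cov i q′
    ... | j , eq = suc j , eq

  enumeration⇒inverse : ∀ {n} (h : Fin n → Carrier) → IsEnumeration h →
                        Inverse (≡.setoid (Fin n)) S
  enumeration⇒inverse h (inj , cov) = record
    { to        = h
    ; from      = proj₁ ∘ cov
    ; to-cong   = λ { ≡.refl → refl }
    ; from-cong = λ {x} {y} x≈y → inj (trans (proj₂ (cov x)) (trans x≈y (sym (proj₂ (cov y)))))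
    ; inverse   = (λ { {x} ≡.refl → proj₂ (cov x) })
                , λ {i} {s} s≈hi → inj (trans (proj₂ (cov s)) s≈hi)
    }

  enumerate : ∀ {m} (Q : Fin m → Set ℓ) (g : ∀ i → Q i → Carrier) →
              (∀ i q q′ → g i q ≈ g i q′) → (∀ s → ∃[ i ] ∃[ q ] g i q ≈ s) →
              ∃[ n ] Σ (Fin n → Carrier) IsEnumeration
  enumerate Q g irr cover with dedupe Q g irr
  ... | n , h , inj , cov = n , h , inj , λ s →
    let i , q , eq = cover s ; j , eq′ = cov i q in j , trans eq′ eq

-- Field arithmetic, synthetic division and finiteness of root sets.

module FieldFacts {ℓ} (em : ExcludedMiddle ℓ) (F : HeytingField ℓ ℓ ℓ) where
  private module F = HeytingField F
  open CommutativeRing (fieldRing F) public hiding (zero)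
  open Polynomials (fieldRing F) public
  open import Algebra.Properties.Ring ring public using (-1*x≈-x; -‿distribˡ-*; -‿involutive)
  open import Algebra.Properties.Group +-group public
    using (x≈y⇒x∙y⁻¹≈ε; x∙y⁻¹≈ε⇒x≈y)
  open import Algebra.Apartness.Properties.HeytingCommutativeRing F.heytingCommutativeRing
    using (x-0≈x; 1#0)
  open import Algebra.Solver.Ring.NaturalCoefficients.Default commutativeSemiring public
    using (solve; _:=_; _:+_; _:*_)
  open import Algebra.Properties.Semiring.Exp semiring public using (_^_)
  open import Relation.Binary.Reasoning.Setoid setoid

  1≉0 : ¬ (1# ≈ 0#)
  1≉0 eq = proj₂ (F.tight 1# 0#) eq 1#0

  inverse : ∀ {x} → ¬ (x ≈ 0#) → ∃[ y ] y * x ≈ 1#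
  inverse {x} x≉0 with em {x F.# 0#}
  ... | no ¬x#0 = ⊥-elim (x≉0 (proj₁ (F.tight x 0#) ¬x#0))
  ... | yes x#0 with F.#⇒invertible x#0
  ...   | y , yx≈1 , _ = y , trans (*-congˡ (sym (x-0≈x x))) yx≈1

  cancel-nonzero : ∀ {x y} → ¬ (x ≈ 0#) → x * y ≈ 0# → y ≈ 0#
  cancel-nonzero {x} {y} x≉0 xy≈0 with inverse x≉0
  ... | z , zx≈1 = begin
    y           ≈⟨ *-identityˡ y ⟨
    1# * y      ≈⟨ *-congʳ zx≈1 ⟨
    (z * x) * y ≈⟨ *-assoc z x y ⟩
    z * (x * y) ≈⟨ *-congˡ xy≈0 ⟩
    z * 0#      ≈⟨ zeroʳ z ⟩
    0#          ∎

  Zero : Poly → Set ℓ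
  Zero = All (_≈ 0#)

  Zero⇒coeff≈0 : ∀ {p} → Zero p → ∀ i → coeff p i ≈ 0#
  Zero⇒coeff≈0 []       i         = refl
  Zero⇒coeff≈0 (eq ∷ _) zero    = eq
  Zero⇒coeff≈0 (_ ∷ p)  (suc i) = Zero⇒coeff≈0 p i

  hasDegree⇒nonzero : ∀ {p n} → HasDegree p n → ¬ Zero p
  hasDegree⇒nonzero (lead , _) p≈0 = lead (Zero⇒coeff≈0 p≈0 _)

  eval-cong : ∀ p {x y} → x ≈ y → eval p x ≈ eval p y
  eval-cong []      x≈y = refl
  eval-cong (a ∷ p) x≈y = +-congˡ (*-cong x≈y (eval-cong p x≈y))

  -- Synthetic division: the quotient of a ∷ p by X- α does not depend on a.
  quotient : Carrier → Poly → Poly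
  quotient α []      = []
  quotient α (a ∷ p) = eval (a ∷ p) α ∷ quotient α p

  -- This is f(x) - f(α) = (x - α) q(x) with the subtractions moved across, so that the solver for
  -- commutative semirings applies.
  quotient-correct : ∀ a p α x →
    eval (a ∷ p) x + α * eval (quotient α p) x ≈ eval (a ∷ p) α + x * eval (quotient α p) x
  quotient-correct a []      α x = solve 3
    (λ a α x → (a :+ x :* con 0) :+ α :* con 0 := (a :+ α :* con 0) :+ x :* con 0) refl a α x
    where open import Algebra.Solver.Ring.NaturalCoefficients.Default commutativeSemiring using (con)
  quotient-correct a (b ∷ p) α x = begin
    (a + x * P) + α * (P′ + x * Q)  ≈⟨ solve 6 (λ a x P α P′ Q →
      (a :+ x :* P) :+ α :* (P′ :+ x :* Q) := (a :+ α :* P′) :+ x :* (P :+ α :* Q)) refl a x P α P′ Q ⟩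
    (a + α * P′) + x * (P + α * Q)  ≈⟨ +-congˡ (*-congˡ (quotient-correct b p α x)) ⟩
    (a + α * P′) + x * (P′ + x * Q) ∎
    where
    P = eval (b ∷ p) x
    P′ = eval (b ∷ p) α
    Q = eval (quotient α p) x

  -- The entries of the quotient are Horner values, and each coefficient of the dividend is one
  -- Horner value minus α times the next. Dividing by a root thus keeps a nonzero polynomial
  -- nonzero.
  quotient-zero : ∀ a p α → eval (a ∷ p) α ≈ 0# → Zero (quotient α p) → Zero (a ∷ p)
  quotient-zero a []      α eq []           =
    trans (sym (trans (+-congˡ (zeroʳ α)) (+-identityʳ a))) eq ∷ []
  quotient-zero a (b ∷ p) α eq (eq′ ∷ rest) =
    trans (sym (trans (+-congˡ (trans (*-congˡ eq′) (zeroʳ α))) (+-identityʳ a))) eq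
      ∷ quotient-zero b p α eq′ rest

  length-quotient : ∀ α p → length (quotient α p) ≡ length p
  length-quotient α []      = ≡.refl
  length-quotient α (_ ∷ p) = ≡.cong suc (length-quotient α p)

  -- Induction on the length: once a root α is split off, every other root is a root of the shorter
  -- quotient, since a field has no zero divisors.
  roots-bounded : ∀ n p → length p ≡ n → ¬ Zero p →
                  ∃[ rs ] (∀ x → eval p x ≈ 0# → Any (x ≈_) rs)
  roots-bounded n []      _ p≉0 = ⊥-elim (p≉0 [])
  roots-bounded (suc n) (a ∷ p) len p≉0 with em {∃[ α ] eval (a ∷ p) α ≈ 0#}
  ... | no none = [] , λ x eq → ⊥-elim (none (x , eq))
  ... | yes (α , root) with roots-bounded n (quotient α p)
                              (≡.trans (length-quotient α p) (≡.cong ℕ.pred len))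
                              (p≉0 ∘ quotient-zero a p α root)
  ...   | rs , cov = α ∷ rs , cov′
    where
    cov′ : ∀ x → eval (a ∷ p) x ≈ 0# → Any (x ≈_) (α ∷ rs)
    cov′ x eq with em {x ≈ α}
    ... | yes x≈α = here x≈α
    ... | no x≉α = there (cov x (cancel-nonzero (x≉α ∘ x∙y⁻¹≈ε⇒x≈y x α) (begin
      (x - α) * Q             ≈⟨ distribʳ Q x (- α) ⟩
      x * Q + - α * Q         ≈⟨ +-congʳ xQ≈αQ ⟩
      α * Q + - α * Q         ≈⟨ distribʳ Q α (- α) ⟨
      (α - α) * Q             ≈⟨ *-congʳ (-‿inverseʳ α) ⟩
      0# * Q                  ≈⟨ zeroˡ Q ⟩
      0#                      ∎)))
      where
      Q = eval (quotient α p) x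
      xQ≈αQ : x * Q ≈ α * Q
      xQ≈αQ = begin
        x * Q                    ≈⟨ +-identityˡ _ ⟨
        0# + x * Q               ≈⟨ +-congʳ root ⟨
        eval (a ∷ p) α + x * Q   ≈⟨ quotient-correct a p α x ⟨
        eval (a ∷ p) x + α * Q   ≈⟨ +-congʳ eq ⟩
        0# + α * Q               ≈⟨ +-identityˡ _ ⟩
        α * Q                    ∎

  roots : ∀ p → ¬ Zero p → ∃[ rs ] (∀ x → eval p x ≈ 0# → Any (x ≈_) rs)
  roots p = roots-bounded (length p) p ≡.refl

  snoc-eval : ∀ p a y → eval (p ++ a ∷ []) y ≈ a * y ^ length p + eval p y
  snoc-eval []      a y = trans (+-congˡ (zeroʳ y)) (+-congʳ (sym (*-identityʳ a)))
  snoc-eval (b ∷ p) a y = trans (+-congˡ (*-congˡ (snoc-eval p a y)))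
    (solve 5 (λ b y a t s → b :+ y :* (a :* t :+ s) := a :* (y :* t) :+ (b :+ y :* s)) refl
      b y a (y ^ length p) (eval p y))

  snoc-degree : ∀ p → HasDegree (p ++ 1# ∷ []) (length p)
  snoc-degree p = (λ eq → 1≉0 (trans (lead p) eq)) , high p
    where
    lead : ∀ p → 1# ≈ coeff (p ++ 1# ∷ []) (length p)
    lead []      = refl
    lead (_ ∷ p) = lead p
    high : ∀ p i → length p ℕ.< i → coeff (p ++ 1# ∷ []) i ≈ 0#
    high []      (suc i) _           = refl
    high (_ ∷ p) (suc i) (ℕ.s≤s len<i) = high p i len<i

least : ∀ {ℓ} → ExcludedMiddle ℓ → (P : ℕ → Set ℓ) → ∃ P →
        ∃[ m ] P m × (∀ j → j ℕ.< m → ¬ P j)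
least em P (n , Pn) = <-rec (λ n → P n → ∃[ m ] P m × (∀ j → j ℕ.< m → ¬ P j)) step n Pn
  where
  step : ∀ n → (∀ {k} → k ℕ.< n → P k → _) → P n → _
  step n rec Pn with em {∃[ k ] k ℕ.< n × P k}
  ... | yes (k , k<n , Pk) = rec k<n Pk
  ... | no none = n , Pn , λ j j<n Pj → none (j , j<n , Pj)

-- Polynomial expressions over K and embeddings as tuples.

module Conjugation {ℓ} (em : ExcludedMiddle ℓ) {K : HeytingField ℓ ℓ ℓ}
                   (closureK : AlgebraicClosure K) where
  open AlgebraicClosure closureK
  open FieldFacts em closure
  private
    module K = FieldFacts em K
    module ι = RingMorphisms.IsRingHomomorphism ι-isHomomorphism
  open import Relation.Binary.Reasoning.Setoid setoid

  infixl 6 _⊕_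
  infixl 7 _⊗_

  -- Polynomials over K in arbitrarily many variables. `X` may be infinite, which allows a whole
  -- field to be indexed by its own elements.
  data Expr {x} (X : Set x) : Set (x ⊔ ℓ) where
    con     : K.Carrier → Expr X
    var     : X → Expr X
    _⊕_ _⊗_ : Expr X → Expr X → Expr X

  ⟦_⟧ : ∀ {x} {X : Set x} → Expr X → (X → Carrier) → Carrier
  ⟦ con k ⟧ u = ι k
  ⟦ var x ⟧ u = u x
  ⟦ e ⊕ f ⟧ u = ⟦ e ⟧ u + ⟦ f ⟧ u
  ⟦ e ⊗ f ⟧ u = ⟦ e ⟧ u * ⟦ f ⟧ u

  ⟦⟧-cong : ∀ {x} {X : Set x} (e : Expr X) {u v} → (∀ x → u x ≈ v x) → ⟦ e ⟧ u ≈ ⟦ e ⟧ v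
  ⟦⟧-cong (con k) eq = refl
  ⟦⟧-cong (var x) eq = eq x
  ⟦⟧-cong (e ⊕ f) eq = +-cong (⟦⟧-cong e eq) (⟦⟧-cong f eq)
  ⟦⟧-cong (e ⊗ f) eq = *-cong (⟦⟧-cong e eq) (⟦⟧-cong f eq)

  module _ {x} {X : Set x} where

    neg : Expr X → Expr X
    neg e = con (K.- K.1#) ⊗ e

    ⟦neg⟧ : ∀ e u → ⟦ neg e ⟧ u ≈ - ⟦ e ⟧ u
    ⟦neg⟧ e u = trans (*-congʳ (trans (ι.-‿homo K.1#) (-‿cong ι.1#-homo))) (-1*x≈-x _)

    subst : ∀ {y} {Y : Set y} → (X → Expr Y) → Expr X → Expr Y
    subst s (con k) = con k
    subst s (var x) = s x
    subst s (e ⊕ f) = subst s e ⊕ subst s f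
    subst s (e ⊗ f) = subst s e ⊗ subst s f

    ⟦subst⟧ : ∀ {y} {Y : Set y} (s : X → Expr Y) e u → ⟦ subst s e ⟧ u ≡ ⟦ e ⟧ (λ x → ⟦ s x ⟧ u)
    ⟦subst⟧ s (con k) u = ≡.refl
    ⟦subst⟧ s (var x) u = ≡.refl
    ⟦subst⟧ s (e ⊕ f) u = ≡.cong₂ _+_ (⟦subst⟧ s e u) (⟦subst⟧ s f u)
    ⟦subst⟧ s (e ⊗ f) u = ≡.cong₂ _*_ (⟦subst⟧ s e u) (⟦subst⟧ s f u)

    horner : K.Poly → Expr X → Expr X
    horner []      e = con K.0#
    horner (a ∷ p) e = con a ⊕ e ⊗ horner p e

    ⟦horner⟧ : ∀ p e u → ⟦ horner p e ⟧ u ≈ eval (map ι p) (⟦ e ⟧ u)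
    ⟦horner⟧ []      e u = ι.0#-homo
    ⟦horner⟧ (a ∷ p) e u = +-congˡ (*-congˡ (⟦horner⟧ p e u))

  ι-nonzero : ∀ {k} → ¬ (k K.≈ K.0#) → ¬ (ι k ≈ 0#)
  ι-nonzero {k} k≉0 ιk≈0 with K.inverse k≉0
  ... | k⁻¹ , eq = 1≉0 (begin
    1#            ≈⟨ ι.1#-homo ⟨
    ι K.1#        ≈⟨ ι.⟦⟧-cong eq ⟨
    ι (k⁻¹ K.* k) ≈⟨ ι.*-homo k⁻¹ k ⟩
    ι k⁻¹ * ι k   ≈⟨ *-congˡ ιk≈0 ⟩
    ι k⁻¹ * 0#    ≈⟨ zeroʳ _ ⟩
    0#            ∎)

  -- If a + t P(t) = 0 with a ≠ 0 constant then t⁻¹ = - a⁻¹ P(t).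
  inverse-from-root : ∀ {x} {X : Set x} (e : Expr X) u p → ¬ K.Zero p →
    ¬ (⟦ e ⟧ u ≈ 0#) → eval (map ι p) (⟦ e ⟧ u) ≈ 0# → ∃[ d ] ⟦ d ⟧ u * ⟦ e ⟧ u ≈ 1#
  inverse-from-root e u []      p≉0 t≉0 root = ⊥-elim (p≉0 [])
  inverse-from-root e u (a ∷ p) p≉0 t≉0 root with em {a K.≈ K.0#}
  ... | yes a≈0 = inverse-from-root e u p (λ p≈0 → p≉0 (a≈0 ∷ p≈0)) t≉0
    (cancel-nonzero t≉0 (begin
      t * P       ≈⟨ +-identityˡ _ ⟨
      0# + t * P  ≈⟨ +-congʳ (trans (ι.⟦⟧-cong a≈0) ι.0#-homo) ⟨
      ι a + t * P ≈⟨ root ⟩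
      0#          ∎))
    where
    t = ⟦ e ⟧ u
    P = eval (map ι p) t
  ... | no a≉0 with K.inverse a≉0
  ...   | b , ba≈1 = con (K.- b) ⊗ horner p e , sym (x∙y⁻¹≈ε⇒x≈y _ _ (begin
    1# - ⟦ con (K.- b) ⊗ horner p e ⟧ u * t ≈⟨ +-congˡ (trans (-‿cong (trans (*-congʳ (*-cong (ι.-‿homo b) (⟦horner⟧ p e u)))
                                                 (trans (*-assoc _ _ _) (sym (-‿distribˡ-* _ _))))) (-‿involutive _)) ⟩
    1# + ι b * (P * t)                      ≈⟨ +-cong (sym (trans (sym (ι.*-homo b a)) (trans (ι.⟦⟧-cong ba≈1) ι.1#-homo)))
                                                 (*-congˡ (*-comm P t)) ⟩
    ι b * ι a + ι b * (t * P)               ≈⟨ distribˡ (ι b) (ι a) (t * P) ⟨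
    ι b * (ι a + t * P)                     ≈⟨ *-congˡ root ⟩
    ι b * 0#                                ≈⟨ zeroʳ _ ⟩
    0#                                      ∎))
    where
    t = ⟦ e ⟧ u
    P = eval (map ι p) t

  -- Every value is algebraic over K, so K[u] is already the field K(u); expressions without
  -- division therefore describe all of K(u).
  inverse-expr : ∀ {x} {X : Set x} (e : Expr X) u → ¬ (⟦ e ⟧ u ≈ 0#) → ∃[ d ] ⟦ d ⟧ u * ⟦ e ⟧ u ≈ 1#
  inverse-expr e u t≉0 with algebraic (⟦ e ⟧ u)
  ... | p , _ , deg , root = inverse-from-root e u p (K.hasDegree⇒nonzero deg) t≉0 root

  infix 4 _∼_

  -- The K-embeddings K(u) → K̄ correspond to the tuples v with u ∼ v.
  record _∼_ {x} {X : Set x} (u v : X → Carrier) : Set (x ⊔ ℓ) where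
    constructor mk∼
    field zero-transfer : ∀ e → ⟦ e ⟧ u ≈ 0# → ⟦ e ⟧ v ≈ 0#
  open _∼_

  ∼-transfer : ∀ {x} {X : Set x} {u v : X → Carrier} → u ∼ v → ∀ e f →
               ⟦ e ⟧ u ≈ ⟦ f ⟧ u → ⟦ e ⟧ v ≈ ⟦ f ⟧ v
  ∼-transfer {u = u} {v} σ e f eq = x∙y⁻¹≈ε⇒x≈y _ _ (trans (+-congˡ (sym (⟦neg⟧ f v)))
    (zero-transfer σ (e ⊕ neg f) (trans (+-congˡ (⟦neg⟧ f u)) (x≈y⇒x∙y⁻¹≈ε eq))))

  unit-transfer : ∀ {x} {X : Set x} {u v : X → Carrier} → u ∼ v → ∀ d e →
               ⟦ d ⟧ u * ⟦ e ⟧ u ≈ 1# → ⟦ d ⟧ v * ⟦ e ⟧ v ≈ 1#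
  unit-transfer σ d e eq =
    trans (∼-transfer σ (d ⊗ e) (con K.1#) (trans eq (sym ι.1#-homo))) ι.1#-homo

  -- Field homomorphisms are injective: if `e` vanished at v but not at u, an inverse `d` of `e` at
  -- u would remain an inverse at v, giving 1 = 0.
  ∼-sym : ∀ {x} {X : Set x} {u v : X → Carrier} → u ∼ v → v ∼ u
  ∼-sym {u = u} {v} σ = mk∼ back
    where
    back : ∀ e → ⟦ e ⟧ v ≈ 0# → ⟦ e ⟧ u ≈ 0#
    back e ev≈0 with em {⟦ e ⟧ u ≈ 0#}
    ... | yes eu≈0 = eu≈0
    ... | no eu≉0 with inverse-expr e u eu≉0
    ...   | d , de≈1 = ⊥-elim (1≉0 (trans (sym (unit-transfer σ d e de≈1))
                                     (trans (*-congˡ ev≈0) (zeroʳ _))))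

  -- Restricts an embedding to the subfield generated by the expressions `s`; it also serves to
  -- rename or drop generators.
  ∼-subst : ∀ {x y} {X : Set x} {Y : Set y} {u v : X → Carrier} {u′ v′ : Y → Carrier} →
            u ∼ v → (s : Y → Expr X) →
            (∀ y → ⟦ s y ⟧ u ≈ u′ y) → (∀ y → ⟦ s y ⟧ v ≈ v′ y) → u′ ∼ v′
  ∼-subst {u = u} {v} {u′} {v′} σ s equ eqv = mk∼ λ e e≈0 → begin
    ⟦ e ⟧ v′                    ≈⟨ ⟦⟧-cong e eqv ⟨
    ⟦ e ⟧ (λ y → ⟦ s y ⟧ v)     ≡⟨ ⟦subst⟧ s e v ⟨
    ⟦ subst s e ⟧ v             ≈⟨ zero-transfer σ (subst s e) (begin
      ⟦ subst s e ⟧ u             ≡⟨ ⟦subst⟧ s e u ⟩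
      ⟦ e ⟧ (λ y → ⟦ s y ⟧ u)     ≈⟨ ⟦⟧-cong e equ ⟩
      ⟦ e ⟧ u′                    ≈⟨ e≈0 ⟩
      0#                          ∎) ⟩
    0#                          ∎

  -- Leading coefficient first: the value of c ∷ cs is c zᵏ + ⋯, k the length of cs.
  val : ∀ {x} {X : Set x} {k} → Vec (Expr X) k → (X → Carrier) → Carrier → Carrier
  val []               u z = 0#
  val {k = suc k} (c ∷ cs) u z = ⟦ c ⟧ u * z ^ k + val cs u z

  -- Combinations of powers of one element, over two fields in parallel.

  module Span {x} {X : Set x} (u v : X → Carrier) (z w : Carrier) where

    -- Sharing one coefficient vector between the two evaluations makes every reduction carried out
    -- at u and z happen simultaneously at v and w.
    Span : ℕ → Carrier → Carrier → Set _
    Span k p q = Σ (Vec (Expr X) k) λ cs → p ≈ val cs u z × q ≈ val cs v w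

    span-resp : ∀ {k p q p′ q′} → p′ ≈ p → q′ ≈ q → Span k p q → Span k p′ q′
    span-resp p≈ q≈ (cs , eqp , eqq) = cs , trans p≈ eqp , trans q≈ eqq

    private
      val-+ : ∀ {k} (cs ds : Vec (Expr X) k) u z →
              val cs u z + val ds u z ≈ val (Vec.zipWith _⊕_ cs ds) u z
      val-+ []       []       u z = +-identityˡ 0#
      val-+ {suc k} (c ∷ cs) (d ∷ ds) u z = trans
        (solve 5 (λ c d y s t → (c :* y :+ s) :+ (d :* y :+ t) := (c :+ d) :* y :+ (s :+ t)) refl
          (⟦ c ⟧ u) (⟦ d ⟧ u) (z ^ k) (val cs u z) (val ds u z))
        (+-congˡ (val-+ cs ds u z))

      val-* : ∀ {k} e (cs : Vec (Expr X) k) u z →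
              ⟦ e ⟧ u * val cs u z ≈ val (Vec.map (e ⊗_) cs) u z
      val-* e []       u z = zeroʳ _
      val-* e (c ∷ cs) u z = trans (distribˡ _ _ _)
        (+-cong (sym (*-assoc _ _ _)) (val-* e cs u z))

      shift : ∀ {k} → Vec (Expr X) k → Vec (Expr X) (suc k)
      shift []       = con K.0# ∷ []
      shift (c ∷ cs) = c ∷ shift cs

      ι0* : ∀ y → ι K.0# * y ≈ 0#
      ι0* y = trans (*-congʳ ι.0#-homo) (zeroˡ y)

      val-shift : ∀ {k} (cs : Vec (Expr X) k) u z → z * val cs u z ≈ val (shift cs) u z
      val-shift []       u z = trans (zeroʳ z) (sym (trans (+-identityʳ _) (ι0* _)))
      val-shift {suc k} (c ∷ cs) u z = trans
        (solve 4 (λ c y z s → z :* (c :* y :+ s) := c :* (z :* y) :+ z :* s) refl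
          (⟦ c ⟧ u) (z ^ k) z (val cs u z))
        (+-congˡ (val-shift cs u z))

    span-+ : ∀ {k p q p′ q′} → Span k p q → Span k p′ q′ → Span k (p + p′) (q + q′)
    span-+ (cs , p , q) (ds , p′ , q′) = Vec.zipWith _⊕_ cs ds
      , trans (+-cong p p′) (val-+ cs ds u z) , trans (+-cong q q′) (val-+ cs ds v w)

    span-* : ∀ {k p q} e → Span k p q → Span k (⟦ e ⟧ u * p) (⟦ e ⟧ v * q)
    span-* e (cs , p , q) = Vec.map (e ⊗_) cs
      , trans (*-congˡ p) (val-* e cs u z) , trans (*-congˡ q) (val-* e cs v w)

    span-shift : ∀ {k p q} → Span k p q → Span (suc k) (z * p) (w * q)
    span-shift (cs , p , q) = shift cs
      , trans (*-congˡ p) (val-shift cs u z) , trans (*-congˡ q) (val-shift cs v w)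

    span-suc : ∀ {k p q} → Span k p q → Span (suc k) p q
    span-suc (cs , p , q) = con K.0# ∷ cs
      , trans p (sym (trans (+-congʳ (ι0* _)) (+-identityˡ _)))
      , trans q (sym (trans (+-congʳ (ι0* _)) (+-identityˡ _)))

    span-0 : ∀ k → Span k 0# 0#
    span-0 zero    = [] , refl , refl
    span-0 (suc k) = span-suc (span-0 k)

    span-1 : ∀ k → Span (suc k) 1# 1#
    span-1 zero    = con K.1# ∷ [] , one , one
      where
      one : 1# ≈ ι K.1# * 1# + 0#
      one = sym (trans (+-identityʳ _) (trans (*-identityʳ _) ι.1#-homo))
    span-1 (suc k) = span-suc (span-1 k)

    -- With a monic relation of degree m, the span of 1, …, z^(m-1) is a ring.
    module Monic {m} (rel : Span (suc m) (z ^ suc m) (w ^ suc m)) where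

      span-z* : ∀ {p q} → Span (suc m) p q → Span (suc m) (z * p) (w * q)
      span-z* s with span-shift s
      -- After the shift the leading term is `c` times the power m + 1, which `rel` rewrites; the
      -- remaining `ds` already has the right length.
      ... | c ∷ ds , p , q = span-resp p q (span-+ (span-* c rel) (ds , refl , refl))

      span-pow* : ∀ k {p q} → Span (suc m) p q → Span (suc m) (z ^ k * p) (w ^ k * q)
      span-pow* zero    s = span-resp (*-identityˡ _) (*-identityˡ _) s
      span-pow* (suc k) s = span-resp (*-assoc _ _ _) (*-assoc _ _ _) (span-z* (span-pow* k s))

      span-val* : ∀ {k} (cs : Vec (Expr X) k) {p q} → Span (suc m) p q →
                  Span (suc m) (val cs u z * p) (val cs v w * q)
      span-val* []       s = span-resp (zeroˡ _) (zeroˡ _) (span-0 _)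
      span-val* {suc k} (c ∷ cs) s =
        span-resp (split _ _ _ _) (split _ _ _ _) (span-+ (span-* c (span-pow* k s)) (span-val* cs s))
        where
        split : ∀ a y s p → (a * y + s) * p ≈ a * (y * p) + s * p
        split a y s p = trans (distribʳ p _ _) (+-congʳ (*-assoc a y p))

      span-mul : ∀ {p q p′ q′} → Span (suc m) p q → Span (suc m) p′ q′ → Span (suc m) (p * p′) (q * q′)
      span-mul (cs , p , q) s = span-resp (*-congʳ p) (*-congʳ q) (span-val* cs s)

      span-coefficient : ∀ e → Span (suc m) (⟦ e ⟧ u) (⟦ e ⟧ v)
      span-coefficient e =
        span-resp (sym (*-identityʳ _)) (sym (*-identityʳ _)) (span-* e (span-1 m))

      -- Powers beyond m are reduced by the relation, so an arbitrary expression in u and z comes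
      -- down to m + 1 coefficients over K(u), and the same coefficients serve v and w.
      span-expr : ∀ e → Span (suc m) (⟦ e ⟧ (maybe′ u z)) (⟦ e ⟧ (maybe′ v w))
      span-expr (con k)        = span-coefficient (con k)
      span-expr (var (just x)) = span-coefficient (var x)
      span-expr (var nothing)  =
        span-resp (sym (*-identityʳ _)) (sym (*-identityʳ _)) (span-z* (span-1 m))
      span-expr (e ⊕ f)        = span-+ (span-expr e) (span-expr f)
      span-expr (e ⊗ f)        = span-mul (span-expr e) (span-expr f)

  val-zero : ∀ {x} {X : Set x} {k} (cs : Vec (Expr X) k) {u} z →
             VecAll.All (λ c → ⟦ c ⟧ u ≈ 0#) cs → val cs u z ≈ 0#
  val-zero []       z []         = refl
  val-zero (c ∷ cs) z (eq ∷ eqs) =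
    trans (+-cong (trans (*-congʳ eq) (zeroˡ _)) (val-zero cs z eqs)) (+-identityˡ _)

  -- Extending an embedding by one element.

  module Adjoin {X : Set ℓ} {u v : X → Carrier} (σ : u ∼ v) (z : Carrier) where

    private module S₁ = Span u u z z

    -- With both sides of `Span` equal, this is a monic polynomial of degree k over K(u) vanishing
    -- at z; the least such k is the degree of z over K(u).
    MonicRelation : ℕ → Set ℓ
    MonicRelation k = S₁.Span k (z ^ k) (z ^ k)

    -- A nonzero leading coefficient could be inverted, turning the dependence into a monic relation
    -- of degree below k. Hence the powers of z below the minimal degree are linearly independent
    -- over K(u).
    independent : ∀ {k} → (∀ j → j ℕ.< k → ¬ MonicRelation j) → (cs : Vec (Expr X) k) →
                  val cs u z ≈ 0# → VecAll.All (λ c → ⟦ c ⟧ u ≈ 0#) cs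
    independent         none []       eq = []
    independent {suc k} none (c ∷ cs) eq with em {⟦ c ⟧ u ≈ 0#}
    ... | yes c≈0 = c≈0 ∷ independent (λ j j<k → none j (ℕ.m<n⇒m<1+n j<k)) cs
      (trans (sym (trans (+-congʳ (trans (*-congʳ c≈0) (zeroˡ _))) (+-identityˡ _))) eq)
    ... | no c≉0 with inverse-expr c u c≉0
    ...   | d , dc≈1 =
      ⊥-elim (none k ℕ.≤-refl (S₁.span-resp leading leading (S₁.span-* (neg d) (cs , refl , refl))))
      where
      leading : z ^ k ≈ ⟦ neg d ⟧ u * val cs u z
      leading = x∙y⁻¹≈ε⇒x≈y _ _ (begin
        z ^ k - ⟦ neg d ⟧ u * val cs u z
          ≈⟨ +-congˡ (trans (-‿cong (trans (*-congʳ (⟦neg⟧ d u)) (sym (-‿distribˡ-* _ _)))) (-‿involutive _)) ⟩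
        z ^ k + ⟦ d ⟧ u * val cs u z
          ≈⟨ +-congʳ (trans (sym (*-identityˡ _)) (*-congʳ (sym dc≈1))) ⟩
        (⟦ d ⟧ u * ⟦ c ⟧ u) * z ^ k + ⟦ d ⟧ u * val cs u z
          ≈⟨ trans (distribˡ _ _ _) (+-congʳ (sym (*-assoc _ _ _))) ⟨
        ⟦ d ⟧ u * (⟦ c ⟧ u * z ^ k + val cs u z)
          ≈⟨ trans (*-congˡ eq) (zeroʳ _) ⟩
        0# ∎)

    -- Bridges two conventions: polynomials over K store the constant term first, coefficient
    -- vectors the leading one.
    split-leading : ∀ p n → (∀ i → n ℕ.< i → K.coeff p i K.≈ K.0#) →
      ∃[ r ] S₁.Span n r r × eval (map ι p) z ≈ ι (K.coeff p n) * z ^ n + r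
    split-leading []      n       _    = 0# , S₁.span-0 n , sym (trans (+-identityʳ _)
      (trans (*-congʳ ι.0#-homo) (zeroˡ _)))
    split-leading (a ∷ p) zero    high = 0# , S₁.span-0 0 , +-cong (sym (*-identityʳ _))
      (trans (*-congˡ (eval-zero p λ i → high (suc i) (ℕ.s≤s ℕ.z≤n))) (zeroʳ z))
      where
      eval-zero : ∀ p → (∀ i → K.coeff p i K.≈ K.0#) → eval (map ι p) z ≈ 0#
      eval-zero []      _  = refl
      eval-zero (a ∷ p) eq = trans
        (+-cong (trans (ι.⟦⟧-cong (eq 0)) ι.0#-homo) (trans (*-congˡ (eval-zero p (eq ∘ suc))) (zeroʳ z)))
        (+-identityˡ _)
    split-leading (a ∷ p) (suc n) high with split-leading p n (λ i n<i → high (suc i) (ℕ.s≤s n<i))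
    ... | r , s , eq = ι a + z * r
      , S₁.span-+ (S₁.span-resp (sym (*-identityʳ _)) (sym (*-identityʳ _)) (S₁.span-* (con a) (S₁.span-1 n)))
                  (S₁.span-shift s)
      , trans (+-congˡ (*-congˡ eq))
          (solve 5 (λ a z c y r → a :+ z :* (c :* y :+ r) := c :* (z :* y) :+ (a :+ z :* r)) refl
            (ι a) z (ι (K.coeff p n)) (z ^ n) r)

    -- Without any monic relation all powers of z would be independent, and the nonzero leading
    -- coefficient of an equation for z over K would have to vanish.
    monicRelation : ∃ MonicRelation
    monicRelation with em {∃ MonicRelation}
    ... | yes rel = rel
    ... | no none with algebraic z
    ...   | p , n , (lead , high) , root with split-leading p n high
    ...     | r , (cs , r≈ , _) , eq with independent (λ j _ rel → none (j , rel)) (con (K.coeff p n) ∷ cs)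
                                            (trans (+-congˡ (sym r≈)) (trans (sym eq) root))
    ...       | lead≈0 ∷ _ = ⊥-elim (ι-nonzero lead lead≈0)

    coefficients : ∀ {k} → Vec (Expr X) k → Poly
    coefficients []       = []
    coefficients (c ∷ cs) = coefficients cs ++ ⟦ c ⟧ v ∷ []

    length-coefficients : ∀ {k} (cs : Vec (Expr X) k) → length (coefficients cs) ≡ k
    length-coefficients []       = ≡.refl
    length-coefficients (c ∷ cs) = ≡.trans (length-++ (coefficients cs))
      (≡.trans (ℕ.+-comm _ 1) (≡.cong suc (length-coefficients cs)))

    eval-coefficients : ∀ {k} (cs : Vec (Expr X) k) y → eval (coefficients cs) y ≈ val cs v y
    eval-coefficients []       y = refl
    eval-coefficients (c ∷ cs) y = trans (snoc-eval (coefficients cs) (⟦ c ⟧ v) y)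
      (+-cong (*-congˡ (reflexive (≡.cong (y ^_) (length-coefficients cs)))) (eval-coefficients cs y))

    -- w is a root of the image of the minimal polynomial of z over K(u).
    adjoin : ∃[ w ] maybe′ u z ∼ maybe′ v w
    adjoin with least em MonicRelation monicRelation
    -- A relation of degree 0 reads 1 = 0.
    ... | zero  , ([] , 1≈0 , _) , _ = ⊥-elim (1≉0 1≈0)
    ... | suc m , (cs , rel , _) , minimal
      -- The relation with coefficients moved to K(v) and all terms on one side; the appended 1
      -- makes its degree exactly m + 1, so the closure has a root of it.
      with algebraicallyClosed (coefficients (Vec.map neg cs) ++ 1# ∷ []) m
             (≡.subst (HasDegree (coefficients (Vec.map neg cs) ++ 1# ∷ [])) (length-coefficients (Vec.map neg cs))
             (snoc-degree (coefficients (Vec.map neg cs))))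
    ...   | w , root = w , mk∼ transfer
      where
      open Span u v z w
      root-relation : w ^ suc m ≈ val cs v w
      root-relation = x∙y⁻¹≈ε⇒x≈y _ _ (begin
        w ^ suc m - val cs v w
          ≈⟨ +-congˡ (trans (sym (⟦neg⟧-val cs)) (sym (eval-coefficients (Vec.map neg cs) w))) ⟩
        w ^ suc m + eval (coefficients (Vec.map neg cs)) w
          ≈⟨ +-congʳ (sym (trans (*-identityˡ _) (reflexive (≡.cong (w ^_) (length-coefficients (Vec.map neg cs)))))) ⟩
        1# * w ^ length (coefficients (Vec.map neg cs)) + eval (coefficients (Vec.map neg cs)) w
          ≈⟨ snoc-eval (coefficients (Vec.map neg cs)) 1# w ⟨
        eval (coefficients (Vec.map neg cs) ++ 1# ∷ []) w
          ≈⟨ root ⟩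
        0# ∎)
        where
        ⟦neg⟧-val : ∀ {k} (cs : Vec (Expr X) k) → val (Vec.map neg cs) v w ≈ - val cs v w
        ⟦neg⟧-val []       = sym ε⁻¹≈ε
          where open import Algebra.Properties.Group +-group using (ε⁻¹≈ε)
        ⟦neg⟧-val (c ∷ cs) = trans
          (+-cong (trans (*-congʳ (⟦neg⟧ c v)) (sym (-‿distribˡ-* _ _))) (⟦neg⟧-val cs))
          (⁻¹-∙-comm _ _)
          where
          open import Algebra.Properties.AbelianGroup +-abelianGroup using (⁻¹-∙-comm)
      transfer : ∀ e → ⟦ e ⟧ (maybe′ u z) ≈ 0# → ⟦ e ⟧ (maybe′ v w) ≈ 0#
      -- Reduced modulo the relation, `e` has coefficients that vanish at u by minimality of the
      -- degree, hence at v by `σ`; so the same combination vanishes at w.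
      transfer e e≈0 with Monic.span-expr (cs , rel , root-relation) e
      ... | ds , eqp , eqq = trans eqq (val-zero ds w
        (VecAll.map (λ {c} → zero-transfer σ c) (independent minimal ds (trans (sym eqp) e≈0))))

  -- Induction on n, adjoining `t zero` first. Only `t` is finite: u may list a whole field, which
  -- is how isomorphisms enter later.
  extend : ∀ n {X : Set ℓ} {u v : X → Carrier} → u ∼ v → (t : Fin n → Carrier) →
           ∃[ t′ ] [ u , t ]′ ∼ [ v , t′ ]′
  extend zero    σ t = (λ ()) ,
    ∼-subst σ [ var , (λ ()) ]′ (λ { (inj₁ _) → refl }) (λ { (inj₁ _) → refl })
  extend (suc n) σ t with Adjoin.adjoin σ (t zero)
  ... | w , σ′ with extend n σ′ (t ∘ suc)
  ...   | t′ , τ = w ◂ t′ , ∼-subst τ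
    (λ { (inj₁ x)       → var (inj₁ (just x))
       ; (inj₂ zero)    → var (inj₁ nothing)
       ; (inj₂ (suc i)) → var (inj₂ i) })
    (λ { (inj₁ _) → refl ; (inj₂ zero) → refl ; (inj₂ (suc _)) → refl })
    (λ { (inj₁ _) → refl ; (inj₂ zero) → refl ; (inj₂ (suc _)) → refl })

-- Images of intermediate fields under embeddings.

module Images {ℓ} (em : ExcludedMiddle ℓ) {K : HeytingField ℓ ℓ ℓ}
              (closureK : AlgebraicClosure K) where
  open AlgebraicClosure closureK
  open FieldFacts em closure
  open Conjugation em closureK
  open _∼_
  open Extensions closureK
  open Extension
  private
    module K = FieldFacts em K
    module ι = RingMorphisms.IsRingHomomorphism ι-isHomomorphism
  open import Relation.Binary.Reasoning.Setoid setoid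

  Tuple : ℕ → Set ℓ
  Tuple r = Fin r → Carrier

  Generated : ∀ {r} → Tuple r → Carrier → Set ℓ
  Generated u y = ∃[ e ] ⟦ e ⟧ u ≈ y

  -- The image of E ∩ K(u) under the embedding K(u) → K̄ sending u to v.
  image : ∀ {r} {u v : Tuple r} → u ∼ v → Extension → Extension
  image {u = u} {v} σ E = record
    { Mem        = λ y → ∃[ e ] Mem E (⟦ e ⟧ u) × ⟦ e ⟧ v ≈ y
    ; resp       = λ { y≈z (e , m , eq) → e , m , trans eq y≈z }
    ; ι-mem      = λ k → con k , ι-mem E k , refl
    ; +-closed   = λ { (e , m , eq) (f , n , eq′) → e ⊕ f , +-closed E m n , +-cong eq eq′ }
    ; neg-closed = λ { (e , m , eq) → neg e , resp E (sym (⟦neg⟧ e u)) (neg-closed E m)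
                                     , trans (⟦neg⟧ e v) (-‿cong eq) }
    ; *-closed   = λ { (e , m , eq) (f , n , eq′) → e ⊗ f , *-closed E m n , *-cong eq eq′ }
    ; inv-closed = inv
    }
    where
    inv : ∀ {x y} → x * y ≈ 1# → ∃[ e ] Mem E (⟦ e ⟧ u) × ⟦ e ⟧ v ≈ x →
          ∃[ e ] Mem E (⟦ e ⟧ u) × ⟦ e ⟧ v ≈ y
    -- As x is a unit, `e` does not vanish at u. Its inverse `d` there takes the value y at v,
    -- because inverses are unique.
    inv {x} {y} xy≈1 (e , m , eq) with inverse-expr e u eu≉0
      where
      eu≉0 : ¬ (⟦ e ⟧ u ≈ 0#)
      eu≉0 eu≈0 = 1≉0 (trans (sym xy≈1)
        (trans (*-congʳ (trans (sym eq) (zero-transfer σ e eu≈0))) (zeroˡ y)))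
    ... | d , de≈1 = d , inv-closed E (trans (*-comm _ _) de≈1) m , (begin
      ⟦ d ⟧ v           ≈⟨ *-identityʳ _ ⟨
      ⟦ d ⟧ v * 1#      ≈⟨ *-congˡ xy≈1 ⟨
      ⟦ d ⟧ v * (x * y) ≈⟨ *-assoc _ _ _ ⟨
      ⟦ d ⟧ v * x * y   ≈⟨ *-congʳ (*-congˡ eq) ⟨
      ⟦ d ⟧ v * ⟦ e ⟧ v * y ≈⟨ *-congʳ (unit-transfer σ d e de≈1) ⟩
      1# * y            ≈⟨ *-identityˡ y ⟩
      y                 ∎)

  image-mono : ∀ {r} {u v : Tuple r} (σ : u ∼ v) E F → E ≤ F → image σ E ≤ image σ F
  image-mono σ E F E≤F (e , m , eq) = e , E≤F m , eq

  image-cong : ∀ {r} {u v : Tuple r} (σ : u ∼ v) E F → E ≐ₑ F → image σ E ≐ₑ image σ F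
  image-cong σ E F (E≤F , F≤E) = image-mono σ E F E≤F , image-mono σ F E F≤E

  image⊆Generated : ∀ {r} {u v : Tuple r} (σ : u ∼ v) E → Mem (image σ E) ⊆ Generated v
  image⊆Generated σ E (e , _ , eq) = e , eq

  -- `image` sees only the part of E inside K(u), whence the inclusion hypothesis; on that part the
  -- same expressions lead to v and back.
  image-inverse : ∀ {r} {u v : Tuple r} (σ : u ∼ v) (τ : v ∼ u) E → Mem E ⊆ Generated u →
                  image τ (image σ E) ≐ₑ E
  image-inverse {u = u} {v} σ τ E E⊆u = forth , back
    where
    forth : image τ (image σ E) ≤ E
    forth (e , (f , m , eq) , eq′) = resp E (trans (∼-transfer τ f e eq) eq′) m
    back : E ≤ image τ (image σ E)
    back m with E⊆u m
    ... | e , eq = e , (e , resp E (sym eq) m , refl) , eq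

  ≅-trans : ∀ {E F G} → E ≅ F → F ≅ G → E ≅ G
  ≅-trans i j = record
    { to            = J.to ∘ I.to
    ; isIsomorphism = isRingIsomorphism trans I.isIsomorphism J.isIsomorphism
    ; fixes-K       = λ k → trans (⟦⟧-cong′ (I.fixes-K k)) (J.fixes-K k)
    }
    where
    module I = _≅_ i
    module J = _≅_ j
    open import Algebra.Morphism.Construct.Composition using (isRingIsomorphism)
    open RingMorphisms.IsRingIsomorphism J.isIsomorphism using () renaming (⟦⟧-cong to ⟦⟧-cong′)

  -- The isomorphism is the inverse of the embedding: it evaluates the witnessing expression at u.
  -- `σ` gives injectivity, and `∼-sym σ` independence of the witness. Sums and products are
  -- preserved by `refl`, since the image adds and multiplies the expressions themselves.
  image-≅ : ∀ {r} {u v : Tuple r} (σ : u ∼ v) E → Mem E ⊆ Generated u → image σ E ≅ E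
  image-≅ {u = u} {v} σ E E⊆u = record
    { to            = to
    ; isIsomorphism = record
      { isRingMonomorphism = record
        { isRingHomomorphism = record
          { isSemiringHomomorphism = record
            { isNearSemiringHomomorphism = record
              { +-isMonoidHomomorphism = record
                { isMagmaHomomorphism = record
                  { isRelHomomorphism = record { cong = λ {x} {y} → to-cong {x} {y} }
                  ; homo              = λ _ _ → refl
                  }
                ; ε-homo = ι.0#-homo
                }
              ; *-homo = λ _ _ → refl
              }
            ; 1#-homo = ι.1#-homo
            }
          ; -‿homo = λ { (_ , e , _) → ⟦neg⟧ e u }
          }
        ; injective = λ { {_ , e , _ , eq} {_ , f , _ , eq′} eq″ →
            trans (sym eq) (trans (∼-transfer σ e f eq″) eq′) }
        }
      ; surjective = surjective
      }
    ; fixes-K       = λ _ → refl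
    }
    where
    to : Σ Carrier (Mem (image σ E)) → Σ Carrier (Mem E)
    to (_ , e , m , _) = ⟦ e ⟧ u , m
    to-cong : ∀ {x y} → proj₁ x ≈ proj₁ y → proj₁ (to x) ≈ proj₁ (to y)
    to-cong {_ , e , _ , eq} {_ , f , _ , eq′} x≈y =
      ∼-transfer (∼-sym σ) e f (trans eq (trans x≈y (sym eq′)))
    surjective : ∀ y → ∃[ x ] (∀ {z : Σ Carrier (Mem (image σ E))} → proj₁ z ≈ proj₁ x → proj₁ (to z) ≈ proj₁ y)
    surjective (y , m) with E⊆u m
    ... | e , eq = (⟦ e ⟧ v , e , resp E (sym eq) m , refl)
                 , λ {z} z≈ → trans (to-cong {z} {⟦ e ⟧ v , e , resp E (sym eq) m , refl} z≈) eq

  ≐⇒≅ : ∀ {E F} → E ≐ₑ F → E ≅ F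
  ≐⇒≅ (E≤F , F≤E) = record
    { to            = λ { (x , m) → x , E≤F m }
    ; isIsomorphism = record
      { isRingMonomorphism = record
        { isRingHomomorphism = record
          { isSemiringHomomorphism = record
            { isNearSemiringHomomorphism = record
              { +-isMonoidHomomorphism = record
                { isMagmaHomomorphism = record
                  { isRelHomomorphism = record { cong = id }
                  ; homo              = λ _ _ → refl
                  }
                ; ε-homo = refl
                }
              ; *-homo = λ _ _ → refl
              }
            ; 1#-homo = refl
            }
          ; -‿homo = λ _ → refl
          }
        ; injective = id
        }
      ; surjective = λ { (y , m) → (y , F≤E m) , id }
      }
    ; fixes-K       = λ _ → refl
    }

  -- Isomorphisms realised as images under embeddings.

  module _ {E E′ : Extension} (φ : E′ ≅ E) where
    private
      module φ = _≅_ φ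
      module H = RingMorphisms.IsRingIsomorphism φ.isIsomorphism

      -- E serves as the tuple of all its own elements, and `w′` collects their preimages under `φ`;
      -- `w ∼ w′` then says that the inverse of `φ` is a K-embedding of E.
      w w′ : Σ Carrier (Mem E) → Carrier
      w = proj₁
      w′ y = proj₁ (proj₁ (H.surjective y))

      w′∈E′ : ∀ y → Mem E′ (w′ y)
      w′∈E′ y = proj₂ (proj₁ (H.surjective y))

      to-⟦⟧ : ∀ e → Σ (Mem E′ (⟦ e ⟧ w′)) λ m → proj₁ (φ.to (⟦ e ⟧ w′ , m)) ≈ ⟦ e ⟧ w
      to-⟦⟧ (con k) = ι-mem E′ k , φ.fixes-K k
      to-⟦⟧ (var y) = w′∈E′ y , proj₂ (H.surjective y) refl
      to-⟦⟧ (e ⊕ f) with to-⟦⟧ e | to-⟦⟧ f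
      ... | m , eq | n , eq′ = +-closed E′ m n , trans (H.+-homo _ _) (+-cong eq eq′)
      to-⟦⟧ (e ⊗ f) with to-⟦⟧ e | to-⟦⟧ f
      ... | m , eq | n , eq′ = *-closed E′ m n , trans (H.*-homo _ _) (*-cong eq eq′)

      w∼w′ : w ∼ w′
      w∼w′ = mk∼ λ e e≈0 → let m , eq = to-⟦⟧ e in
        H.injective {⟦ e ⟧ w′ , m} {RawRing.0# (Extension.rawRing E′)} (trans eq (trans e≈0 (sym H.0#-homo)))

      w′-to : ∀ y (m : Mem E′ y) → w′ (φ.to (y , m)) ≈ y
      w′-to y m = H.injective {proj₁ (H.surjective (φ.to (y , m)))} {y , m}
        (proj₂ (H.surjective (φ.to (y , m))) refl)

    -- The inverse of `φ` embeds E, and `extend` continues it to u. The resulting `σ` agrees with it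
    -- on E because every element of E is an expression in u.
    ≅⇒image : ∀ {r} {u : Tuple r} → Mem E ⊆ Generated u →
              ∃[ v ] Σ (u ∼ v) λ σ → E′ ≐ₑ image σ E
    ≅⇒image {r} {u} E⊆u with extend r w∼w′ u
    ... | v , τ = v , σ , E′≤ , ≤E′
      where
      σ : u ∼ v
      σ = ∼-subst τ (var ∘ inj₂) (λ _ → refl) (λ _ → refl)
      -- In the joint tuple of `w` and `u`, the expression `e` and the variable for `y` have equal
      -- values; `τ` carries this equation over to `w′` and `v`.
      agree : ∀ y e → ⟦ e ⟧ u ≈ w y → ⟦ e ⟧ v ≈ w′ y
      agree y e eq = begin
        ⟦ e ⟧ v                               ≡⟨ ⟦subst⟧ (var ∘ inj₂) e [ w′ , v ]′ ⟨
        ⟦ subst (var ∘ inj₂) e ⟧ [ w′ , v ]′  ≈⟨ ∼-transfer τ (subst (var ∘ inj₂) e) (var (inj₁ y)) (begin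
          ⟦ subst (var ∘ inj₂) e ⟧ [ w , u ]′   ≡⟨ ⟦subst⟧ (var ∘ inj₂) e [ w , u ]′ ⟩
          ⟦ e ⟧ u                               ≈⟨ eq ⟩
          w y                                   ∎) ⟩
        w′ y                                  ∎
      E′≤ : E′ ≤ image σ E
      E′≤ {y} m with E⊆u (proj₂ (φ.to (y , m)))
      ... | e , eq = e , resp E (sym eq) (proj₂ (φ.to (y , m)))
                   , trans (agree (φ.to (y , m)) e eq) (w′-to y m)
      ≤E′ : image σ E ≤ E′
      ≤E′ (e , m , eq) = resp E′ (trans (sym (agree (⟦ e ⟧ u , m) e refl)) eq) (w′∈E′ (⟦ e ⟧ u , m))

  root-transfer : ∀ {r} {u v : Tuple r} → u ∼ v → ∀ p e → Root p (⟦ e ⟧ u) → Root p (⟦ e ⟧ v)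
  root-transfer {u = u} {v} σ p e root = trans (sym (⟦horner⟧ p e v))
    (zero-transfer σ (horner p e) (trans (⟦horner⟧ p e u) root))

  root-resp : ∀ p {x y} → x ≈ y → Root p x → Root p y
  root-resp p x≈y root = trans (eval-cong (map ι p) (sym x≈y)) root

  -- The minimal polynomial depends only on which polynomials over K vanish at the element, and
  -- separability only on that polynomial.
  separable-transfer : ∀ {x y} → (∀ p → Root p x → Root p y) → (∀ p → Root p y → Root p x) →
                       IsSeparableElement x → IsSeparableElement y
  separable-transfer to from (p , (n , monic , root , minimal) , sep) =
    p , (n , monic , to p root , λ q m deg root′ → minimal q m deg (from q root′)) , sep

  image-separable : ∀ {r} {u v : Tuple r} (σ : u ∼ v) E → IsSeparable E → IsSeparable (image σ E)
  image-separable σ E sep y (e , m , eq) = separable-transfer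
    (λ p root → root-resp p eq (root-transfer σ p e root))
    (λ p root → root-transfer (∼-sym σ) p e (root-resp p (sym eq) root))
    (sep _ m)

  -- For maximality, a separable F inside the image is pulled back along `∼-sym σ`, lies in M there,
  -- and is pushed forward again by `σ`.
  image-maximalSeparable : ∀ {r} {u v : Tuple r} (σ : u ∼ v) M E → Mem E ⊆ Generated u →
    IsMaximalSeparable M E → IsMaximalSeparable (image σ M) (image σ E)
  image-maximalSeparable {u = u} {v} σ M E E⊆u (M≤E , sep , maximal) =
    image-mono σ M E M≤E , image-separable σ M sep , maximal′
    where
    τ : v ∼ u
    τ = ∼-sym σ
    maximal′ : ∀ F → F ≤ image σ E → IsSeparable F → F ≤ image σ M
    maximal′ F F≤ sepF m =
      image-mono σ (image τ F) M
        (maximal (image τ F)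
          (proj₁ (image-inverse σ τ E E⊆u) ∘ image-mono τ F (image σ E) F≤)
          (image-separable τ F sepF))
        (proj₂ (image-inverse τ σ F (image⊆Generated σ E ∘ F≤)) m)

  maximalSeparable-unique : ∀ {M M′ E} → IsMaximalSeparable M E → IsMaximalSeparable M′ E → M ≐ₑ M′
  maximalSeparable-unique {M} {M′} (M≤E , sepM , maxM) (M′≤E , sepM′ , maxM′) =
    maxM′ M M≤E sepM , maxM M′ M′≤E sepM′

  maximalSeparable-resp : ∀ {M M′ E E′} → M ≐ₑ M′ → E ≐ₑ E′ → IsMaximalSeparable M E → IsMaximalSeparable M′ E′
  maximalSeparable-resp (M≤M′ , M′≤M) (E≤E′ , E′≤E) (M≤E , sepM , maxM) =
    (λ m → E≤E′ (M≤E (M′≤M m))) , (λ x m → sepM x (M′≤M m)) , λ F F≤E′ sepF m → M≤M′ (maxM F (E′≤E ∘ F≤E′) sepF m)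

-- A missed value `i` could be punched out, leaving an injection of `Fin (suc n)` into `Fin n`.
injective⇒surjective : ∀ {n} (f : Fin n → Fin n) → (∀ {i j} → f i ≡ f j → i ≡ j) →
                       ∀ i → ∃[ j ] f j ≡ i
injective⇒surjective {suc n} f inj i with any? (λ j → f j ≟ i)
... | yes found = found
... | no none = ⊥-elim (ℕ.1+n≰n (injective⇒≤ {f = λ j → punchOut (avoid j)}
                  (λ {j} {k} eq → inj (punchOut-injective (avoid j) (avoid k) eq))))
  where
  avoid : ∀ j → ¬ (i ≡ f j)
  avoid j eq = none (j , ≡.sym eq)

-- `_/_` normalises, so the equation is checked by cross-multiplying unnormalised fractions.
ratio : ∀ b c .{{_ : NonZero b}} → + c / 1 ≡ + (b ℕ.* c) / b
ratio (suc b) c = fromℚᵘ-cong {mkℚᵘ (+ c) 0} {mkℚᵘ (+ (suc b ℕ.* c)) b} (*≡* (begin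
  + c ℤ.* + suc b             ≡⟨ ℤ.*-comm (+ c) (+ suc b) ⟩
  + suc b ℤ.* + c             ≡⟨ ℤ.pos-* (suc b) c ⟨
  + (suc b ℕ.* c)             ≡⟨ ℤ.*-identityʳ _ ⟨
  + (suc b ℕ.* c) ℤ.* + 1     ∎))
  where open ≡.≡-Reasoning

-- Normal tuples and enumeration of conjugates.

module Normal {ℓ} (em : ExcludedMiddle ℓ) {K : HeytingField ℓ ℓ ℓ}
              (closureK : AlgebraicClosure K) where
  open AlgebraicClosure closureK
  open FieldFacts em closure
  open Conjugation em closureK
  open Images em closureK
  open Extensions closureK
  open Extension
  private
    module K = FieldFacts em K
    module ι = RingMorphisms.IsRingHomomorphism ι-isHomomorphism
  open import Algebra.Properties.Monoid.Sum +-monoid using (sum)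

  map-ι-nonzero : ∀ {p} → ¬ K.Zero p → ¬ Zero (map ι p)
  map-ι-nonzero p≉0 ιp≈0 = p≉0 (reflect _ ιp≈0)
    where
    reflect : ∀ p → Zero (map ι p) → K.Zero p
    reflect []      []         = []
    reflect (a ∷ p) (eq ∷ eqs) with em {a K.≈ K.0#}
    ... | yes a≈0 = a≈0 ∷ reflect p eqs
    ... | no a≉0 = ⊥-elim (ι-nonzero a≉0 eq)

  common-roots : ∀ n (p : Fin n → K.Poly) → (∀ i → ¬ K.Zero (p i)) →
                 ∃[ rs ] (∀ i x → Root (p i) x → Any (x ≈_) rs)
  common-roots zero    p p≉0 = [] , λ ()
  common-roots (suc n) p p≉0 with roots (map ι (p zero)) (map-ι-nonzero (p≉0 zero))
                                | common-roots n (p ∘ suc) (p≉0 ∘ suc)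
  ... | rs , cov | ss , cov′ = rs ++ ss , λ
    { zero    x root → Any.++⁺ˡ (cov x root)
    ; (suc i) x root → Any.++⁺ʳ rs (cov′ i x root) }

  -- K(u) is normal and its generators are listed without repetition.
  record IsNormal {r} (u : Tuple r) : Set ℓ where
    field
      distinct : ∀ {i j} → u i ≈ u j → i ≡ j
      closed   : ∀ {v} → u ∼ v → ∀ i → ∃[ j ] u j ≈ v i

  generated-sum : ∀ {r n} (u : Tuple r) (a : Fin n → K.Carrier) (b : Tuple n) →
                  (∀ i → Generated u (b i)) → Generated u (sum (λ i → ι (a i) * b i))
  generated-sum {n = zero}  u a b gen = con K.0# , ι.0#-homo
  generated-sum {n = suc n} u a b gen with gen zero | generated-sum u (a ∘ suc) (b ∘ suc) (gen ∘ suc)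
  ... | e , eq | f , eq′ = con (a zero) ⊗ e ⊕ f , +-cong (*-congˡ eq) eq′

  normalTuple : ∀ L → IsFinite L → ∃[ r ] Σ (Tuple r) λ u → IsNormal u × Mem L ⊆ Generated u
  normalTuple L (n , b , _ , spanning) =
    let r , h , inj , cover = enumeration
        u = proj₁ ∘ h
        closed : ∀ {v} → u ∼ v → ∀ i → ∃[ j ] u j ≈ v i
        closed {v} σ i = let _ , k , root = h i in
          cover (v i , k , root-transfer σ (p k) (var i) root)
        b-generated : ∀ i → Generated u (b i)
        b-generated i = let j , eq = cover (b i , i , b-root i) in var j , eq
    in r , u , record { distinct = inj ; closed = λ {v} → closed {v} } , λ {x} m →
      let a , eq = spanning x m
          e , eq′ = generated-sum u a b b-generated
      in e , trans eq′ (sym eq)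
    where
    p : Fin n → K.Poly
    p i = proj₁ (algebraic (b i))
    p-nonzero : ∀ i → ¬ K.Zero (p i)
    p-nonzero i with algebraic (b i)
    ... | _ , _ , deg , _ = K.hasDegree⇒nonzero deg
    b-root : ∀ i → Root (p i) (b i)
    b-root i with algebraic (b i)
    ... | _ , _ , _ , root = root

    -- Each root keeps the index of its polynomial, so that an embedding is known to send it to a
    -- root of the same polynomial; equality forgets the index.
    Roots : Setoid ℓ ℓ
    Roots = record
      { Carrier       = ∃[ x ] ∃[ i ] Root (p i) x
      ; _≈_           = λ x y → proj₁ x ≈ proj₁ y
      ; isEquivalence = record { refl = refl ; sym = sym ; trans = trans }
      }
    enumeration : ∃[ r ] Σ (Fin r → Setoid.Carrier Roots) (Enumeration.IsEnumeration em Roots)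
    enumeration with common-roots n p p-nonzero
    ... | rs , cov = Enumeration.enumerate em Roots
      -- `common-roots` promises only that no root is missing; this condition retains the entries
      -- that are roots, and `enumerate` removes repetitions.
      (λ j → ∃[ i ] Root (p i) (lookup rs j)) (λ j q → lookup rs j , q) (λ _ _ _ → refl)
      λ { (x , i , root) →
        let any = cov i x root ; eq = Any.lookup-index any
        in Any.index any , (i , root-resp (p i) eq root) , sym eq }

  generated-trans : ∀ {r s} {u : Tuple r} {v : Tuple s} → (∀ i → Generated u (v i)) →
                    Generated v ⊆ Generated u
  generated-trans {u = u} gen (e , eq) =
    subst (proj₁ ∘ gen) e , trans (reflexive (⟦subst⟧ (proj₁ ∘ gen) e u)) (trans (⟦⟧-cong e (proj₂ ∘ gen)) eq)

  module _ {r} {u : Tuple r} (normal : IsNormal u) where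
    open IsNormal normal

    conjugate⊆ : ∀ {v} → u ∼ v → Generated v ⊆ Generated u
    conjugate⊆ {v} σ = generated-trans λ i → let j , eq = closed {v} σ i in var j , eq

    -- v permutes the distinct entries of u.
    ⊆conjugate : ∀ {v} → u ∼ v → Generated u ⊆ Generated v
    ⊆conjugate {v} σ = generated-trans λ i →
      let j , fj≡i = injective⇒surjective f f-injective i
      in var j , trans (sym (u∘f j)) (reflexive (≡.cong u fj≡i))
      where
      f : Fin r → Fin r
      f i = proj₁ (closed {v} σ i)
      u∘f : ∀ i → u (f i) ≈ v i
      u∘f i = proj₂ (closed {v} σ i)
      f-injective : ∀ {i j} → f i ≡ f j → i ≡ j
      f-injective {i} {j} eq = distinct (∼-transfer (∼-sym σ) (var i) (var j)
        (trans (sym (u∘f i)) (trans (reflexive (≡.cong u eq)) (u∘f j))))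

    -- The self-maps of the index set form a finite search space. By normality every embedding of
    -- K(u) occurs among them, and `u ∼ permuted k` selects those that are embeddings.
    permuted : Fin (r ℕ.^ r) → Tuple r
    permuted k = u ∘ finToFun k

    ≅⇒permuted : ∀ {E E′} → Mem E ⊆ Generated u → E′ ≅ E →
                 ∃[ k ] Σ (u ∼ permuted k) λ σ → E′ ≐ₑ image σ E
    ≅⇒permuted {E} E⊆u φ with ≅⇒image φ E⊆u
    ... | v , σ , E′≤ , ≤E′ = funToFin f , ∼-subst σ var (λ _ → refl) (sym ∘ v≈)
      , (λ m → let e , n , eq = E′≤ m in e , n , trans (⟦⟧-cong e v≈) eq)
      , (λ { (e , n , eq) → ≤E′ (e , n , trans (sym (⟦⟧-cong e v≈)) eq) })
      where
      f : Fin r → Fin r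
      f i = proj₁ (closed {v} σ i)
      v≈ : ∀ i → permuted (funToFin f) i ≈ v i
      v≈ i = trans (reflexive (≡.cong u (finToFun-funToFin f i))) (proj₂ (closed {v} σ i))

    Conjugates : Extension → Setoid _ ℓ
    Conjugates E = extensionsWith (_≅ E)

    enumerate-conjugates : ∀ E → Mem E ⊆ Generated u →
      ∃[ n ] Σ (Fin n → Setoid.Carrier (Conjugates E)) (Enumeration.IsEnumeration em (Conjugates E))
    enumerate-conjugates E E⊆u = Enumeration.enumerate em (Conjugates E)
      (λ k → u ∼ permuted k) (λ k σ → image σ E , image-≅ σ E E⊆u) (λ _ _ _ → ≐-refl)
      λ { (E′ , φ) → let k , σ , eq = ≅⇒permuted E⊆u φ in k , σ , ≐-sym eq }

    -- Counting the conjugates of L over those of its separable part.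

    module _ (L Lₛ : Extension) (L⊆u : Mem L ⊆ Generated u) (maxₛ : IsMaximalSeparable Lₛ L) where

      Fibre : Setoid _ ℓ
      Fibre = extensionsWith (λ L′ → (L′ ≅ L) × IsMaximalSeparable Lₛ L′)

      -- The maximal separable part of σL is σ(Lₛ), so σL belongs to the fibre exactly when σ maps
      -- Lₛ onto itself; the candidates are filtered by that condition.
      enumerate-fibre : ∃[ n ] Σ (Fin n → Setoid.Carrier Fibre) (Enumeration.IsEnumeration em Fibre)
      enumerate-fibre = Enumeration.enumerate em Fibre
        (λ k → Σ (u ∼ permuted k) λ σ → image σ Lₛ ≐ₑ Lₛ)
        (λ { k (σ , eq) → image σ L , image-≅ σ L L⊆u
           , maximalSeparable-resp {image σ Lₛ} {Lₛ} {image σ L} {image σ L} eq ≐-refl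
               (image-maximalSeparable σ Lₛ L L⊆u maxₛ) })
        (λ _ _ _ → ≐-refl)
        λ { (L′ , φ , max′) → let k , σ , eq = ≅⇒permuted L⊆u φ in
          k , (σ , maximalSeparable-unique {image σ Lₛ} {Lₛ} {L′}
                     (maximalSeparable-resp {image σ Lₛ} {image σ Lₛ} {image σ L} {L′} ≐-refl (≐-sym eq)
                       (image-maximalSeparable σ Lₛ L L⊆u maxₛ)) max′)
            , ≐-sym eq }

      module Counting
        {b} (hB : Fin b → Setoid.Carrier (Conjugates Lₛ))
        (enumB : Enumeration.IsEnumeration em (Conjugates Lₛ) hB)
        {c} (hF : Fin c → Setoid.Carrier Fibre)
        (enumF : Enumeration.IsEnumeration em Fibre hF)
        {v : Fin b → Tuple r} (σ : ∀ j → u ∼ v j)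
        (M≐ : ∀ j → proj₁ (hB j) ≐ₑ image (σ j) Lₛ) where

        M : Fin b → Extension
        M j = proj₁ (hB j)

        -- Lₛ is a conjugate of itself, so its enumeration has at least one index.
        b≢0 : NonZero b
        b≢0 = nonZeroIndex (proj₁ (proj₂ enumB (Lₛ , ≐⇒≅ ≐-refl)))

        Lₛ⊆u : Mem Lₛ ⊆ Generated u
        Lₛ⊆u m = L⊆u (proj₁ maxₛ m)

        F : Fin c → Extension
        F i = proj₁ (hF i)

        -- A conjugate of L is an image of L under an embedding of K(u), and K(u) is normal.
        conjugate-generated : ∀ {E} → E ≅ L → Mem E ⊆ Generated u
        conjugate-generated φ m with ≅⇒image φ L⊆u
        ... | w , τ , E≤ , _ = conjugate⊆ τ (image⊆Generated τ L (E≤ m))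

        F⊆u : ∀ i → Mem (F i) ⊆ Generated u
        F⊆u i = conjugate-generated (proj₁ (proj₂ (hF i)))

        translate : Fin b → Fin c → Extension
        translate j i = image (σ j) (F i)

        translate-≅ : ∀ j i → translate j i ≅ L
        translate-≅ j i = ≅-trans (image-≅ (σ j) (F i) (F⊆u i)) (proj₁ (proj₂ (hF i)))

        translate-max : ∀ j i → IsMaximalSeparable (M j) (translate j i)
        translate-max j i = maximalSeparable-resp {image (σ j) Lₛ} {M j} {translate j i} {translate j i}
          (≐-sym (M≐ j)) ≐-refl (image-maximalSeparable (σ j) Lₛ (F i) (F⊆u i) (proj₂ (proj₂ (hF i))))

        -- The maximal separable part of a translate is `M j`, which determines j because `hB` has
        -- no repetitions; the inverse of `σ j` then recovers `F i`.
        translate-injective : ∀ j i j′ i′ → translate j i ≐ₑ translate j′ i′ → (j , i) ≡ (j′ , i′)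
        translate-injective j i j′ i′ eq
          with proj₁ enumB {j} {j′} (maximalSeparable-unique {M j} {M j′} {translate j′ i′}
                 (maximalSeparable-resp {M j} {M j} {translate j i} {translate j′ i′} ≐-refl eq (translate-max j i))
                 (translate-max j′ i′))
        ... | ≡.refl = ≡.cong (j ,_) (proj₁ enumF
          (≐-trans (≐-sym (image-inverse (σ j) (∼-sym (σ j)) (F i) (F⊆u i)))
          (≐-trans (image-cong (∼-sym (σ j)) (translate j i) (translate j i′) eq)
                   (image-inverse (σ j) (∼-sym (σ j)) (F i′) (F⊆u i′)))))

        maximalSeparable-index : ∀ {w} (τ : u ∼ w) E → E ≐ₑ image τ L →
                                 ∃[ j ] IsMaximalSeparable (M j) E
        maximalSeparable-index τ E E≐ =
          let j , Mj≐ = proj₂ enumB (image τ Lₛ , image-≅ τ Lₛ Lₛ⊆u)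
          in j , maximalSeparable-resp {image τ Lₛ} {M j} {image τ L} {E} (≐-sym Mj≐) (≐-sym E≐)
                   (image-maximalSeparable τ Lₛ L L⊆u maxₛ)

        -- The inverse of `σ j` carries `M j` to Lₛ, hence E into the fibre, where it is some `F i`;
        -- `σ j` brings that back to E.
        translate-onto : ∀ E → E ≅ L → ∀ j → IsMaximalSeparable (M j) E → ∃[ i ] translate j i ≐ₑ E
        translate-onto E φ j max =
          let i , Fi≐ = proj₂ enumF (E₀ , ≅-trans (image-≅ σ⁻¹ E E⊆v) φ , max₀)
          in i , ≐-trans (image-cong (σ j) (F i) E₀ Fi≐) (image-inverse σ⁻¹ (σ j) E E⊆v)
          where
          σ⁻¹ : v j ∼ u
          σ⁻¹ = ∼-sym (σ j)
          E₀ : Extension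
          E₀ = image σ⁻¹ E
          E⊆v : Mem E ⊆ Generated (v j)
          -- E lies in K(u) as a conjugate of L, and `v j` generates all of K(u).
          E⊆v m = ⊆conjugate (σ j) (conjugate-generated φ m)
          max₀ : IsMaximalSeparable Lₛ E₀
          max₀ = maximalSeparable-resp {image σ⁻¹ (M j)} {Lₛ} {E₀} {E₀}
            (≐-trans (image-cong σ⁻¹ (M j) (image (σ j) Lₛ) (M≐ j)) (image-inverse (σ j) σ⁻¹ Lₛ Lₛ⊆u))
            ≐-refl
            (image-maximalSeparable σ⁻¹ (M j) E E⊆v max)

        translate-surjective : ∀ E → E ≅ L → ∃[ j ] ∃[ i ] translate j i ≐ₑ E
        translate-surjective E φ =
          let _ , τ , E≐ = ≅⇒image φ L⊆u
              j , max = maximalSeparable-index τ E E≐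
          in j , translate-onto E φ j max

        cardL : s[ L ]= (b ℕ.* c)
        cardL = Enumeration.enumeration⇒inverse em (Conjugates L)
          (λ k → let j , i = remQuot {b} c k in translate j i , translate-≅ j i)
          ((λ {k} {k′} eq → ≡.trans (≡.sym (combine-remQuot {b} c k))
            (≡.trans (≡.cong (λ { (j , i) → combine j i }) (translate-injective _ _ _ _ eq))
                     (combine-remQuot {b} c k′)))
          , λ { (E , φ) → let j , i , eq = translate-surjective E φ in
            combine j i , ≡.subst (λ { (j , i) → translate j i ≐ₑ E }) (≡.sym (remQuot-combine j i)) eq })

      counting : ∃[ a ] ∃[ b ] ∃[ c ] Σ (NonZero b) λ b≢0 →
        (s[ L ]= a) × (s[ Lₛ ]= b) ×
        HasCardinality (λ L′ → (L′ ≅ L) × IsMaximalSeparable Lₛ L′) c ×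
        (+ c / 1 ≡ _/_ (+ a) b {{b≢0}})
      counting =
        let b , hB , enumB = enumerate-conjugates Lₛ (λ m → L⊆u (proj₁ maxₛ m))
            c , hF , enumF = enumerate-fibre
            embedding : ∀ j → ∃[ v ] Σ (u ∼ v) λ σ → proj₁ (hB j) ≐ₑ image σ Lₛ
            embedding j = ≅⇒image (proj₂ (hB j)) (λ m → L⊆u (proj₁ maxₛ m))
            open Counting hB enumB hF enumF
              (λ j → proj₁ (proj₂ (embedding j))) (λ j → proj₂ (proj₂ (embedding j)))
        -- The number of conjugates of L is produced as a product with factor `b`, so the quotient
        -- is exactly `c`.
        in b ℕ.* c , b , c , b≢0 , cardL
        , Enumeration.enumeration⇒inverse em (Conjugates Lₛ) hB enumB
        , Enumeration.enumeration⇒inverse em Fibre hF enumF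
        , ratio b c {{b≢0}}

proposition2p19 : ∀ {ℓ} → ExcludedMiddle ℓ →
    (K : HeytingField ℓ ℓ ℓ) (closureK : AlgebraicClosure K) →
    let open Extensions closureK in
    (L Lₛ : Extension) → IsFinite L → IsMaximalSeparable Lₛ L →
    ∃[ a ] ∃[ b ] ∃[ c ] Σ (NonZero b) λ b≢0 →
    (s[ L ]= a) ×
    (s[ Lₛ ]= b) ×
    HasCardinality (λ L′ → (L′ ≅ L) × IsMaximalSeparable Lₛ L′) c ×
    (+ c / 1 ≡ _/_ (+ a) b {{b≢0}})
proposition2p19 em K closureK L Lₛ finite maxₛ =
  let _ , _ , normal , L⊆u = normalTuple L finite in counting normal L Lₛ L⊆u maxₛ
  where open Normal em closureK
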